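{- For any oriented tree $\overrightarrow{T}$ on $n\ge 1$ vertices, $F(\overrightarrow{T})=n-1$.
   Context: A finite simple digraph $D=(V,A)$ has finite nonempty vertex set $V$ and arc set $A$ consisting of ordered pairs of distinct vertices (no loops, no parallel arcs). $N_D^+(v)=\{u:(v,u)\in A\}$. An oriented graph is a digraph in which $(u,v)\in A$ implies $(v,u)\notin A$. An oriented tree is an oriented graph whose underlying undirected graph is a tree. Zero forcing: for $S\subseteq V$ let $B^0(S)=S$ and $B^{i+1}(S)=B^i(S)\cup\{w:\{w\}=N_D^+(v)\setminus B^i(S)\text{ for some }v\in B^i(S)\}$. $S$ is a zero forcing set (ZFS) if $B^t(S)=V$ for some $t\ge 0$, and a failed zero forcing set (FZFS) otherwise. The failed zero forcing number $F(D)$ is the largest cardinality of an FZFS of $D$. -}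

module Defs where

open import Data.Bool using (Bool; T)
import Data.Bool.Properties as Bool
open import Data.Fin using (Fin)
open import Data.Fin.Properties using (any?)
open import Data.Fin.Subset using (Subset; _∈_; _∪_; _─_; ⁅_⁆; ⊤; ∣_∣)
open import Data.Fin.Subset.Properties using (_∈?_)
open import Data.List using (List; _∷_; length; _∷ʳ_)
open import Data.List.Relation.Unary.Linked using (Linked)
open import Data.List.Relation.Unary.Unique.Propositional using (Unique)
open import Data.Nat using (ℕ; zero; suc; _≤_)
open import Data.Product using (∃; _×_)
open import Data.Vec using (tabulate)
open import Data.Vec.Properties using (≡-dec)
open import Level using (0ℓ)
open import Relation.Binary using (Rel)
open import Relation.Binary.Construct.Closure.ReflexiveTransitive using (Star)
open import Relation.Binary.Construct.Closure.Symmetric using (SymClosure)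
open import Relation.Binary.PropositionalEquality using (_≡_)
open import Relation.Nullary using (¬_; Dec; does; _×-dec_)

-- The arc set is a Boolean matrix, so parallel arcs are impossible by
-- construction.
record Digraph (n : ℕ) : Set where
  field
    arc    : Fin n → Fin n → Bool
    noLoop : ∀ v → ¬ T (arc v v)

  Arc : Rel (Fin n) 0ℓ
  Arc u v = T (arc u v)

  N⁺ : Fin n → Subset n
  N⁺ v = tabulate (arc v)

open Digraph public

IsOriented : ∀ {n} → Digraph n → Set
IsOriented D = ∀ u v → Arc D u v → ¬ Arc D v u

Underlying : ∀ {n} → Digraph n → Rel (Fin n) 0ℓ
Underlying D = SymClosure (Arc D)

module _ {n : ℕ} (_~_ : Rel (Fin n) 0ℓ) where

  Connected : Set
  Connected = ∀ u v → Star _~_ u v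

  -- The cycle visiting x, then vs in order, then returning to x; the bound
  -- says that it has at least three vertices.
  IsCycle : Fin n → List (Fin n) → Set
  IsCycle x vs =
    2 ≤ length vs × Unique (x ∷ vs) × Linked _~_ ((x ∷ vs) ∷ʳ x)

  Acyclic : Set
  Acyclic = ∀ x vs → ¬ IsCycle x vs

  -- Intended for n ≥ 1; the empty graph satisfies both conditions vacuously.
  IsTree : Set
  IsTree = Connected × Acyclic

IsOrientedTree : ∀ {n} → Digraph n → Set
IsOrientedTree D = IsOriented D × IsTree (Underlying D)

module _ {n : ℕ} (D : Digraph n) where

  Forces : Subset n → Fin n → Fin n → Set
  Forces S v w = v ∈ S × N⁺ D v ─ S ≡ ⁅ w ⁆

  forces? : ∀ S v w → Dec (Forces S v w)
  forces? S v w = v ∈? S ×-dec ≡-dec Bool._≟_ (N⁺ D v ─ S) ⁅ w ⁆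

  B : ℕ → Subset n → Subset n
  B zero    S = S
  B (suc i) S =
    B i S ∪ tabulate (λ w → does (any? (λ v → forces? (B i S) v w)))

  ZFS : Subset n → Set
  ZFS S = ∃ λ t → B t S ≡ ⊤

  FZFS : Subset n → Set
  FZFS S = ¬ ZFS S

  -- "F(D) = k".  A relation rather than a function, since the largest
  -- cardinality exists only when V is nonempty (then ∅ is a failed zero
  -- forcing set); k is unique by antisymmetry of ≤.
  IsFailedZeroForcingNumber : ℕ → Set
  IsFailedZeroForcingNumber k =
    (∃ λ S → FZFS S × ∣ S ∣ ≡ k) × (∀ S → FZFS S → ∣ S ∣ ≤ k)

{-# OPTIONS --safe #-}

-- Following arcs backwards in a finite digraph in which every vertex has an
-- in-neighbour eventually repeats a vertex and so closes a directed cycle; in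
-- an oriented graph that cycle has length at least three. Hence an oriented
-- tree has a vertex w without in-neighbours. No vertex can force w, so V ∖ {w}
-- is a failed zero forcing set; the only larger set is V, which is not failed.
module Submission where

open import Data.Bool.Properties using (T-≡; T?)
open import Data.Fin using (Fin; zero; suc; toℕ)
open import Data.Fin.Properties using (_≟_; any?; injective⇒≤; ¬∀⟶∃¬)
open import Data.Fin.Subset using (_∈_; _∉_; ⁅_⁆; ∁; ∣_∣)
open import Data.Fin.Subset.Properties
  using (∈⊤; x∈⁅x⁆; x∈p⇒x∉∁p; x∈p∪q⁻; p─q⊆p; ∣∁p∣≡n∸∣p∣; ∣⁅x⁆∣≡1; ∣p∣≤n;
         ∣p∣≡n⇒p≡⊤)
open import Data.List using (List; []; _∷_; length; lookup; take; _∷ʳ_)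
import Data.List.Membership.Propositional as List
open import Data.List.Membership.Propositional.Properties using (∈-lookup)
open import Data.List.Relation.Unary.All as All using ([])
open import Data.List.Relation.Unary.All.Properties using (¬Any⇒All¬)
open import Data.List.Relation.Unary.AllPairs using ([]; _∷_)
open import Data.List.Relation.Unary.Any using (here; there; index)
open import Data.List.Relation.Unary.Linked as Linked using (Linked; [-]; _∷_)
open import Data.List.Relation.Unary.Unique.Propositional using (Unique)
open import Data.List.Relation.Unary.Unique.Propositional.Properties
  using (take⁺)
open import Data.Nat using (ℕ; zero; suc; _+_; _≤_; _<_; _≥_; _∸_; z≤n; s≤s)
open import Data.Nat.Properties
  using (<⇒≱; <⇒≤pred; ≤∧≢⇒<; m≤m+n; +-suc)
open import Data.Product using (∃; ∃₂; _,_)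
open import Data.Sum using (inj₁; inj₂)
open import Data.Vec.Properties using ([]=⇒lookup; lookup∘tabulate)
open import Function using (_∘_; Equivalence; Injective)
open import Level using (0ℓ)
open import Relation.Binary using (Rel; Asymmetric)
open import Relation.Binary.Construct.Closure.Symmetric using (fwd)
open import Relation.Binary.PropositionalEquality
  using (_≡_; refl; sym; trans; cong; subst)
open import Relation.Nullary using (¬_; yes; no; contradiction)
open import Defs

module _ {A : Set} where

  Unique⇒lookup-injective : ∀ {xs : List A} → Unique xs →
    Injective _≡_ _≡_ (lookup xs)
  Unique⇒lookup-injective (_ ∷ _) {zero} {zero} _ = refl
  Unique⇒lookup-injective (x≢ ∷ _) {zero} {suc j} eq =
    contradiction eq (All.lookup x≢ (∈-lookup j))
  Unique⇒lookup-injective (x≢ ∷ _) {suc i} {zero} eq =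
    contradiction (sym eq) (All.lookup x≢ (∈-lookup i))
  Unique⇒lookup-injective (_ ∷ u) {suc i} {suc j} eq =
    cong suc (Unique⇒lookup-injective u eq)

  -- Cutting the walk right after `y` leaves `y` as its last entry, so the step `R y z` can be
  -- appended; the `suc` is there to keep `y` itself. With `z` the head of `xs`, this closes a
  -- cycle.
  Linked-take-∷ʳ : ∀ {R : Rel A 0ℓ} {y z xs} → Linked R xs →
    (y∈xs : y List.∈ xs) → R y z →
    Linked R (take (suc (toℕ (index y∈xs))) xs ∷ʳ z)
  Linked-take-∷ʳ _        (here refl)          Ryz = Ryz ∷ [-]
  -- Splitting once more exposes the head of the remaining prefix, which is the target of `r`.
  Linked-take-∷ʳ (r ∷ rs) (there y∈xs) Ryz with y∈xs
  ... | here refl = r ∷ Ryz ∷ [-]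
  ... | there y∈ = r ∷ Linked-take-∷ʳ rs (there y∈) Ryz

-- Pigeonhole: the positions of the list inject into `Fin n`.
Unique⇒length≤ : ∀ {n} {xs : List (Fin n)} → Unique xs → length xs ≤ n
Unique⇒length≤ u = injective⇒≤ (Unique⇒lookup-injective u)

module _ {n : ℕ} {R : Rel (Fin n) 0ℓ} (asym : Asymmetric R) where

  open import Data.List.Membership.DecPropositional (_≟_ {n})
    using () renaming (_∈?_ to _∈ₗ?_)

  -- The cycle is the prefix of the path ending at `y`. Asymmetry rules out `y` being the first or
  -- second vertex, so at least two vertices follow `x`.
  path-closes : ∀ {x vs y} → Unique (x ∷ vs) → Linked R (x ∷ vs) →
    R y x → y List.∈ x ∷ vs → ∃ (IsCycle R x)
  path-closes _ _ Ryx (here refl) = contradiction Ryx (asym Ryx)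
  path-closes _ (Rxy ∷ _) Ryx (there (here refl)) = contradiction Ryx (asym Rxy)
  path-closes {vs = _ ∷ _ ∷ _} u l Ryx y∈@(there (there _)) =
    _ , s≤s (s≤s z≤n) , take⁺ (suc (toℕ (index y∈))) u , Linked-take-∷ʳ l y∈ Ryx

  module _ (pred : ∀ x → ∃ λ y → R y x) where

    -- `k` is fuel: each new predecessor is prepended, trading one unit of `k` for one of length. At
    -- `k = 0` the path would have more than `n` distinct vertices.
    path-extends-to-cycle : ∀ k {x vs} → n < k + length (x ∷ vs) →
      Unique (x ∷ vs) → Linked R (x ∷ vs) → ∃₂ (IsCycle R)
    path-extends-to-cycle zero n< u _ =
      contradiction (Unique⇒length≤ u) (<⇒≱ n<)
    path-extends-to-cycle (suc k) {x} {vs} n< u l with pred x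
    ... | y , Ryx with y ∈ₗ? (x ∷ vs)
    ... | yes y∈ = x , path-closes u l Ryx y∈
    ... | no y∉ = path-extends-to-cycle k
      (subst (n <_) (sym (+-suc k _)) n<) (¬Any⇒All¬ _ y∉ ∷ u) (Ryx ∷ l)

    cycle : Fin n → ∃₂ (IsCycle R)
    cycle x = path-extends-to-cycle n
      (subst (n <_) (sym (+-suc n 0)) (s≤s (m≤m+n n 0)))
      ([] ∷ []) ([-] {x = x})

module _ {n : ℕ} (D : Digraph n) where

  IsSource : Fin n → Set
  IsSource w = ∀ v → ¬ Arc D v w

  source : Fin n → IsOriented D → Acyclic (Underlying D) → ∃ IsSource
  source x oriented acyclic =
    let arc? v w = T? (arc D v w)
        -- Having an in-neighbour is decidable over finitely many vertices, so refuting it for all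
        -- of them yields an actual `w`.
        w , ¬pred = ¬∀⟶∃¬ n _ (λ w → any? λ v → arc? v w) λ pred →
          let y , vs , 2≤ , u , l = cycle (oriented _ _) pred x
          in acyclic y vs (2≤ , u , Linked.map fwd l)
    in w , λ v v→w → ¬pred (v , v→w)

  Forces⇒Arc : ∀ {S v w} → Forces D S v w → Arc D v w
  Forces⇒Arc {S} {v} {w} (_ , eq) = Equivalence.from T-≡
    (trans (sym (lookup∘tabulate (arc D v) w))
      ([]=⇒lookup (p─q⊆p (N⁺ D v) S (subst (w ∈_) (sym eq) (x∈⁅x⁆ w)))))

  -- By induction on `t`: a vertex added at a step is forced along an arc into it.
  source∉B : ∀ {w S} → IsSource w → w ∉ S → ∀ t → w ∉ B D t S
  source∉B src w∉S zero = w∉S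
  source∉B {w} {S} src w∉S (suc t) w∈ with x∈p∪q⁻ (B D t S) _ w∈
  ... | inj₁ w∈B = source∉B src w∉S t w∈B
  ... | inj₂ w∈forced
    -- Abstracting the decision together with the equation that its Boolean is `true` makes the `no`
    -- case absurd.
    with any? (λ v → forces? D (B D t S) v w)
       | trans (sym (lookup∘tabulate _ w)) ([]=⇒lookup w∈forced)
  ... | yes (v , f) | _ = src v (Forces⇒Arc f)
  ... | no _ | ()

  ∁source-FZFS : ∀ {w} → IsSource w → FZFS D (∁ ⁅ w ⁆)
  ∁source-FZFS {w} src (t , eq) =
    source∉B src (x∈p⇒x∉∁p (x∈⁅x⁆ w)) t (subst (w ∈_) (sym eq) ∈⊤)

  FZFS⇒∣S∣≤n∸1 : ∀ S → FZFS D S → ∣ S ∣ ≤ n ∸ 1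
  FZFS⇒∣S∣≤n∸1 S failed =
    <⇒≤pred (≤∧≢⇒< (∣p∣≤n S) λ eq → failed (0 , ∣p∣≡n⇒p≡⊤ eq))

corollary4p3 : ∀ (n : ℕ) → n ≥ 1 → (D : Digraph n) → IsOrientedTree D →
    IsFailedZeroForcingNumber D (n ∸ 1)
corollary4p3 n@(suc _) _ D (oriented , _ , acyclic) =
  -- As `n` is a successor, `zero` is a vertex from which the backward search can start.
  let w , src = source D zero oriented acyclic
  in (∁ ⁅ w ⁆ , ∁source-FZFS D src ,
      trans (∣∁p∣≡n∸∣p∣ ⁅ w ⁆) (cong (n ∸_) (∣⁅x⁆∣≡1 w))) ,
     FZFS⇒∣S∣≤n∸1 D
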